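{- Let $n\ge 1$ and let $b=(b_1,\dots,b_n)$ be any sequence of positive integers. The lecture hall polytope $P(b)$ has the Integral Decomposition Property: for any integer $k\ge 0$ and any $p=(x_1,\dots,x_n)\in k\cdot P(b)\cap\mathbb{Z}^n$, there exist $p_1,\dots,p_k\in P(b)\cap\mathbb{Z}^n$ such that $p=p_1+\cdots+p_k$.
   Context: The lecture hall polytope with parameters $b=(b_1,\dots,b_n)$ is $P(b):=\{(x_1,\dots,x_n)\in\mathbb{R}^n : 0\le\frac{x_1}{b_1}\le\cdots\le\frac{x_n}{b_n}\le 1\}$; its dilation $k\cdot P(b)$ is given by the same inequalities with the rightmost $1$ replaced by $k$. -}

module Defs where

open import Data.Nat.Base as ℕ using (ℕ)
open import Data.Integer.Base as ℤ using (ℤ; +_)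
import Data.Integer.Properties as ℤ
open import Data.Rational.Base using (ℚ; 0ℚ; 1ℚ; _/_; _÷_; _≤_)
open import Data.Rational.Properties using (pos⇒nonZero; normalize-pos)
open import Data.Vec.Base as Vec using (_∷_; _∷ʳ_)
open import Data.Vec.Functional using (Vector)
open import Data.Vec.Relation.Unary.Linked using (Linked)
open import Relation.Unary using (Pred)
open import Level using (0ℓ)
import Algebra.Definitions.RawMonoid ℤ.+-0-rawMonoid as Sum

-- Polytopes are given by their rational points.  All inequalities below
-- have rational coefficients, so the lattice points are those of the
-- corresponding real polytopes.

divℕ : ℚ → (d : ℕ) → ℕ.NonZero d → ℚ
divℕ q d d≢0 = _÷_ q (+ d / 1) {{pos⇒nonZero (+ d / 1) {{normalize-pos d 1 {{_}} {{d≢0}}}}}}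

module _ {n : ℕ} (b : Vector ℕ n) (b≢0 : ∀ i → ℕ.NonZero (b i)) where

  -- 0 ≤ x₁/b₁ ≤ ⋯ ≤ xₙ/bₙ ≤ t
  LectureHall≤ : ℚ → Pred (Vector ℚ n) 0ℓ
  LectureHall≤ t x =
    Linked _≤_ (0ℚ ∷ (Vec.tabulate (λ i → divℕ (x i) (b i) (b≢0 i)) ∷ʳ t))

  P : Pred (Vector ℚ n) 0ℓ
  P = LectureHall≤ 1ℚ

  Dilated : ℕ → Pred (Vector ℚ n) 0ℓ
  Dilated k = LectureHall≤ (+ k / 1)

toℚⁿ : ∀ {n} → Vector ℤ n → Vector ℚ n
toℚⁿ p i = p i / 1

∑ : ∀ {n k} → Vector (Vector ℤ n) k → Vector ℤ n
∑ ps i = Sum.sum (λ j → ps j i)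

-- The points of S ∩ ℤⁿ.
Lattice : ∀ {n} → Pred (Vector ℚ n) 0ℓ → Pred (Vector ℤ n) 0ℓ
Lattice S p = S (toℚⁿ p)

{-# OPTIONS --safe #-}
-- Cut the interval [0, k] into the unit intervals [j, j + 1].  Taking the part of
-- x / b that lies in the j-th one, namely min(max(x / b − j, 0), 1), is monotone
-- in x / b, so it preserves the chain of inequalities of the polytope; multiplied
-- by b it is the integer min(max(x − j b, 0), b), and the k parts add up to x.
module Submission where

open import Defs
open import Data.Nat.Base using (ℕ; zero; suc; NonZero; _≥_; z≤n)
open import Data.Integer.Base as ℤ using (ℤ; +_; 0ℤ)
import Data.Integer.Properties as ℤ
open import Data.Rational.Base
  using (ℚ; 0ℚ; 1ℚ; _/_; _+_; _-_; -_; _*_; 1/_; _≤_; *≤*; _⊔_; _⊓_; Positive)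
import Data.Rational.Base as ℚ
open import Data.Rational.Literals using (fromℤ)
open import Data.Rational.Properties
open import Data.Fin.Base as Fin using (toℕ)
open import Data.Vec.Base as Vec using (_∷_; _∷ʳ_)
open import Data.Vec.Functional using (Vector)
open import Data.Vec.Relation.Unary.Linked using (Linked; [-]; _∷_)
open import Data.Product.Base using (Σ-syntax; _×_; _,_)
open import Data.Sum.Base using (inj₁; inj₂)
open import Function.Base using (_∘_)
open import Relation.Binary.Core using (_Preserves_⟶_)
open import Relation.Binary.PropositionalEquality
import Algebra.Definitions.RawMonoid ℤ.+-0-rawMonoid as Sum

module _ {f : ℤ → ℚ} (f-mono : f Preserves ℤ._≤_ ⟶ _≤_) where

  -- The order on ℤ is total, so the maximum is one of the two arguments, and a monotone map keeps
  -- it the larger one. With `f` a quotient, this carries the clamp from ℤ to ℚ.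
  mono-distrib-⊔ : ∀ x y → f (x ℤ.⊔ y) ≡ f x ⊔ f y
  mono-distrib-⊔ x y with ℤ.≤-total x y
  ... | inj₁ x≤y = trans (cong f (ℤ.i≤j⇒i⊔j≡j x≤y)) (sym (p≤q⇒p⊔q≡q (f-mono x≤y)))
  ... | inj₂ y≤x = trans (cong f (ℤ.i≥j⇒i⊔j≡i y≤x)) (sym (p≥q⇒p⊔q≡p (f-mono y≤x)))

  mono-distrib-⊓ : ∀ x y → f (x ℤ.⊓ y) ≡ f x ⊓ f y
  mono-distrib-⊓ x y with ℤ.≤-total x y
  ... | inj₁ x≤y = trans (cong f (ℤ.i≤j⇒i⊓j≡i x≤y)) (sym (p≤q⇒p⊓q≡p (f-mono x≤y)))
  ... | inj₂ y≤x = trans (cong f (ℤ.i≥j⇒i⊓j≡j y≤x)) (sym (p≥q⇒p⊓q≡q (f-mono y≤x)))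

-- `x / 1` is normalised through a gcd and is stuck for a variable `x`; `fromℤ x` has the literal
-- denominator 1, so order and arithmetic compute on it.
/1≡fromℤ : ∀ x → x / 1 ≡ fromℤ x
/1≡fromℤ x = ↥p/↧p≡p (fromℤ x)

/1-mono-≤ : ∀ {x y} → x ℤ.≤ y → x / 1 ≤ y / 1
/1-mono-≤ {x} {y} x≤y rewrite /1≡fromℤ x | /1≡fromℤ y =
  *≤* (ℤ.*-monoʳ-≤-nonNeg (+ 1) x≤y)

/1-cancel-≤ : ∀ {x y} → x / 1 ≤ y / 1 → x ℤ.≤ y
/1-cancel-≤ {x} {y} x≤y rewrite /1≡fromℤ x | /1≡fromℤ y with *≤* x*1≤y*1 ← x≤y =
  ℤ.*-cancelʳ-≤-pos x y (+ 1) x*1≤y*1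

/1-homo-* : ∀ x y → (x ℤ.* y) / 1 ≡ x / 1 * (y / 1)
/1-homo-* x y rewrite /1≡fromℤ x | /1≡fromℤ y = refl

/1-homo-+ : ∀ x y → (x ℤ.+ y) / 1 ≡ x / 1 + y / 1
/1-homo-+ x y rewrite /1≡fromℤ x | /1≡fromℤ y =
  cong (_/ 1) (sym (cong₂ ℤ._+_ (ℤ.*-identityʳ x) (ℤ.*-identityʳ y)))

fromℤ-homo-neg : ∀ x → fromℤ (ℤ.- x) ≡ - fromℤ x
fromℤ-homo-neg (+ zero)   = refl
fromℤ-homo-neg (+ suc _)  = refl
fromℤ-homo-neg ℤ.-[1+ _ ] = refl

/1-homo-neg : ∀ x → (ℤ.- x) / 1 ≡ - (x / 1)
/1-homo-neg x rewrite /1≡fromℤ x | /1≡fromℤ (ℤ.- x) = fromℤ-homo-neg x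

module _ (d : ℕ) (d≢0 : NonZero d) where

  private
    instance
      d/1-pos : Positive (+ d / 1)
      d/1-pos = normalize-pos d 1 {{_}} {{d≢0}}

      d/1-nonNeg : ℚ.NonNegative (+ d / 1)
      d/1-nonNeg = pos⇒nonNeg (+ d / 1)

      d/1-nonZero : ℚ.NonZero (+ d / 1)
      d/1-nonZero = pos⇒nonZero (+ d / 1)

      1/d-nonNeg : ℚ.NonNegative (1/ (+ d / 1))
      1/d-nonNeg = pos⇒nonNeg (1/ (+ d / 1)) {{1/pos⇒pos (+ d / 1)}}

  -- Unfolds to the entry that an integer coordinate contributes to `LectureHall≤`.
  quotient : ℤ → ℚ
  quotient x = divℕ (x / 1) d d≢0

  quotient-mono-≤ : quotient Preserves ℤ._≤_ ⟶ _≤_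
  quotient-mono-≤ x≤y = *-monoʳ-≤-nonNeg (1/ (+ d / 1)) (/1-mono-≤ x≤y)

  quotient*d : ∀ x → quotient x * (+ d / 1) ≡ x / 1
  quotient*d x = begin
    x / 1 * 1/ (+ d / 1) * (+ d / 1)    ≡⟨ *-assoc (x / 1) _ _ ⟩
    x / 1 * (1/ (+ d / 1) * (+ d / 1))  ≡⟨ cong (x / 1 *_) (*-inverseˡ (+ d / 1)) ⟩
    x / 1 * 1ℚ                          ≡⟨ *-identityʳ (x / 1) ⟩
    x / 1                               ∎
    where open ≡-Reasoning

  quotient-cancel-≤ : ∀ {x y} → quotient x ≤ quotient y → x ℤ.≤ y
  quotient-cancel-≤ {x} {y} q = /1-cancel-≤
    (subst₂ _≤_ (quotient*d x) (quotient*d y) (*-monoʳ-≤-nonNeg (+ d / 1) q))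

  quotient-multiple : ∀ m → quotient (m ℤ.* + d) ≡ m / 1
  quotient-multiple m = begin
    (m ℤ.* + d) / 1 * 1/ (+ d / 1)      ≡⟨ cong (_* 1/ (+ d / 1)) (/1-homo-* m (+ d)) ⟩
    m / 1 * (+ d / 1) * 1/ (+ d / 1)    ≡⟨ *-assoc (m / 1) _ _ ⟩
    m / 1 * (+ d / 1 * 1/ (+ d / 1))    ≡⟨ cong (m / 1 *_) (*-inverseʳ (+ d / 1)) ⟩
    m / 1 * 1ℚ                          ≡⟨ *-identityʳ (m / 1) ⟩
    m / 1                               ∎
    where open ≡-Reasoning

  quotient-0 : quotient 0ℤ ≡ 0ℚ
  quotient-0 = quotient-multiple 0ℤ

  quotient-d : quotient (+ d) ≡ 1ℚ
  quotient-d = *-inverseʳ (+ d / 1)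

  quotient-minus-d : ∀ x → quotient (x ℤ.- + d) ≡ quotient x - 1ℚ
  quotient-minus-d x = begin
    (x ℤ.- + d) / 1 * r           ≡⟨ cong (_* r) (/1-homo-+ x (ℤ.- + d)) ⟩
    (x / 1 + (ℤ.- + d) / 1) * r   ≡⟨ cong (λ q → (x / 1 + q) * r) (/1-homo-neg (+ d)) ⟩
    (x / 1 + - (+ d / 1)) * r     ≡⟨ *-distribʳ-+ r (x / 1) (- (+ d / 1)) ⟩
    x / 1 * r + - (+ d / 1) * r   ≡⟨ cong (λ q → x / 1 * r + q) (neg-distribˡ-* (+ d / 1) r) ⟨
    x / 1 * r - + d / 1 * r       ≡⟨ cong (λ q → x / 1 * r - q) (*-inverseʳ (+ d / 1)) ⟩
    x / 1 * r - 1ℚ                ∎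
    where
    open ≡-Reasoning
    r = 1/ (+ d / 1)

-- Shifting `x` by `b` at each step, instead of subtracting `j b` at once, makes all slices after
-- the first literally the slices of `x - b`.
slice : ℤ → ℕ → ℤ → ℤ
slice b zero    x = 0ℤ ℤ.⊔ (b ℤ.⊓ x)
slice b (suc j) x = slice b j (x ℤ.- b)

-- The same cut on the scale of `x / b`. It does not depend on `b`, so a single monotone map acts on
-- all coordinates of the chain.
unitSlice : ℕ → ℚ → ℚ
unitSlice zero    q = 0ℚ ⊔ (1ℚ ⊓ q)
unitSlice (suc j) q = unitSlice j (q - 1ℚ)

-- Division by `d` is monotone, so it commutes with the clamp, and it turns each shift by `d` into a
-- shift by 1.
quotient-slice : ∀ d (d≢0 : NonZero d) j x →
                 quotient d d≢0 (slice (+ d) j x) ≡ unitSlice j (quotient d d≢0 x)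
quotient-slice d d≢0 zero x = begin
  quotient d d≢0 (0ℤ ℤ.⊔ (+ d ℤ.⊓ x))
    ≡⟨ mono-distrib-⊔ (quotient-mono-≤ d d≢0) 0ℤ (+ d ℤ.⊓ x) ⟩
  quotient d d≢0 0ℤ ⊔ quotient d d≢0 (+ d ℤ.⊓ x)
    ≡⟨ cong₂ _⊔_ (quotient-0 d d≢0) (mono-distrib-⊓ (quotient-mono-≤ d d≢0) (+ d) x) ⟩
  0ℚ ⊔ (quotient d d≢0 (+ d) ⊓ quotient d d≢0 x)
    ≡⟨ cong (λ q → 0ℚ ⊔ (q ⊓ quotient d d≢0 x)) (quotient-d d d≢0) ⟩
  0ℚ ⊔ (1ℚ ⊓ quotient d d≢0 x)
    ∎
  where open ≡-Reasoning
quotient-slice d d≢0 (suc j) x = trans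
  (quotient-slice d d≢0 j (x ℤ.- + d))
  (cong (unitSlice j) (quotient-minus-d d d≢0 x))

unitSlice-mono-≤ : ∀ j → unitSlice j Preserves _≤_ ⟶ _≤_
unitSlice-mono-≤ zero    p≤q = ⊔-monoʳ-≤ 0ℚ (⊓-monoʳ-≤ 1ℚ p≤q)
unitSlice-mono-≤ (suc j) p≤q = unitSlice-mono-≤ j (+-monoˡ-≤ (- 1ℚ) p≤q)

0≤unitSlice : ∀ j q → 0ℚ ≤ unitSlice j q
0≤unitSlice zero    q = p≤p⊔q 0ℚ (1ℚ ⊓ q)
0≤unitSlice (suc j) q = 0≤unitSlice j (q - 1ℚ)

unitSlice≤1 : ∀ j q → unitSlice j q ≤ 1ℚ
unitSlice≤1 zero    q = ⊔-lub (nonNegative⁻¹ 1ℚ) (p⊓q≤p 1ℚ q)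
unitSlice≤1 (suc j) q = unitSlice≤1 j (q - 1ℚ)

-- Above `b` the clamp is `b` and the excess `x - b`; below `b` the excess vanishes and the clamp is
-- already the positive part.
clamp+excess : ∀ b x → 0ℤ ℤ.≤ b →
               (0ℤ ℤ.⊔ (b ℤ.⊓ x)) ℤ.+ (0ℤ ℤ.⊔ (x ℤ.- b)) ≡ 0ℤ ℤ.⊔ x
clamp+excess b x 0≤b with ℤ.≤-total b x
... | inj₁ b≤x = begin
  (0ℤ ℤ.⊔ (b ℤ.⊓ x)) ℤ.+ (0ℤ ℤ.⊔ (x ℤ.- b))
    ≡⟨ cong (λ y → (0ℤ ℤ.⊔ y) ℤ.+ (0ℤ ℤ.⊔ (x ℤ.- b))) (ℤ.i≤j⇒i⊓j≡i b≤x) ⟩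
  (0ℤ ℤ.⊔ b) ℤ.+ (0ℤ ℤ.⊔ (x ℤ.- b))
    ≡⟨ cong₂ ℤ._+_ (ℤ.i≤j⇒i⊔j≡j 0≤b) (ℤ.i≤j⇒i⊔j≡j (ℤ.i≤j⇒0≤j-i b≤x)) ⟩
  b ℤ.+ (x ℤ.- b)
    ≡⟨ ℤ.+-comm b (x ℤ.- b) ⟩
  x ℤ.- b ℤ.+ b
    ≡⟨ ℤ.+-assoc x (ℤ.- b) b ⟩
  x ℤ.+ (ℤ.- b ℤ.+ b)
    ≡⟨ cong (λ y → x ℤ.+ y) (ℤ.+-inverseˡ b) ⟩
  x ℤ.+ 0ℤ
    ≡⟨ ℤ.+-identityʳ x ⟩
  x
    ≡⟨ ℤ.i≤j⇒i⊔j≡j (ℤ.≤-trans 0≤b b≤x) ⟨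
  0ℤ ℤ.⊔ x
    ∎
  where open ≡-Reasoning
... | inj₂ x≤b = begin
  (0ℤ ℤ.⊔ (b ℤ.⊓ x)) ℤ.+ (0ℤ ℤ.⊔ (x ℤ.- b))
    ≡⟨ cong₂ (λ y z → (0ℤ ℤ.⊔ y) ℤ.+ z)
         (ℤ.i≥j⇒i⊓j≡j x≤b) (ℤ.i≥j⇒i⊔j≡i (ℤ.i≤j⇒i-j≤0 x≤b)) ⟩
  (0ℤ ℤ.⊔ x) ℤ.+ 0ℤ
    ≡⟨ ℤ.+-identityʳ (0ℤ ℤ.⊔ x) ⟩
  0ℤ ℤ.⊔ x
    ∎
  where open ≡-Reasoning

-- The positive part 0 ⊔ x is needed for the induction: x − b may be negative.
sum-slices : ∀ k b x → 0ℤ ℤ.≤ b → x ℤ.≤ + k ℤ.* b →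
             Sum.sum {k} (λ j → slice b (toℕ j) x) ≡ 0ℤ ℤ.⊔ x
-- The bound `+ 0 * b` computes to 0, so the positive part of `x` is 0, the empty sum.
sum-slices zero    b x 0≤b x≤kb = sym (ℤ.i≥j⇒i⊔j≡i x≤kb)
sum-slices (suc k) b x 0≤b x≤kb = trans
  (cong (λ y → (0ℤ ℤ.⊔ (b ℤ.⊓ x)) ℤ.+ y) (sum-slices k b (x ℤ.- b) 0≤b x-b≤kb))
  (clamp+excess b x 0≤b)
  where
  open ℤ.≤-Reasoning
  x-b≤kb : x ℤ.- b ℤ.≤ + k ℤ.* b
  x-b≤kb = begin
    x ℤ.- b                          ≤⟨ ℤ.+-monoˡ-≤ (ℤ.- b) x≤kb ⟩
    + suc k ℤ.* b ℤ.- b              ≡⟨ cong (ℤ._- b) (ℤ.suc-* (+ k) b) ⟩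
    b ℤ.+ + k ℤ.* b ℤ.- b            ≡⟨ cong (ℤ._- b) (ℤ.+-comm b (+ k ℤ.* b)) ⟩
    + k ℤ.* b ℤ.+ b ℤ.- b            ≡⟨ ℤ.+-assoc (+ k ℤ.* b) b (ℤ.- b) ⟩
    + k ℤ.* b ℤ.+ (b ℤ.- b)          ≡⟨ cong (λ y → + k ℤ.* b ℤ.+ y) (ℤ.+-inverseʳ b) ⟩
    + k ℤ.* b ℤ.+ 0ℤ                 ≡⟨ ℤ.+-identityʳ (+ k ℤ.* b) ⟩
    + k ℤ.* b                        ∎

-- The lower end is a parameter so that the tail of a chain is again a chain, starting at the first
-- entry; at 0 this is the shape of `LectureHall≤`.
Chain : ∀ {n} → ℚ → Vector ℚ n → ℚ → Set
Chain s f t = Linked _≤_ (s ∷ (Vec.tabulate f ∷ʳ t))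

chain-ends : ∀ {n s t} (f : Vector ℚ n) → Chain s f t → s ≤ t
chain-ends {zero}  f (s≤t ∷ _) = s≤t
chain-ends {suc n} f (s≤f₀ ∷ c) = ≤-trans s≤f₀ (chain-ends (f ∘ Fin.suc) c)

chain-bounds : ∀ {n s t} (f : Vector ℚ n) → Chain s f t → ∀ i → s ≤ f i × f i ≤ t
chain-bounds f (s≤f₀ ∷ c) Fin.zero    = s≤f₀ , chain-ends (f ∘ Fin.suc) c
chain-bounds f (s≤f₀ ∷ c) (Fin.suc i) with f₀≤fᵢ , fᵢ≤t ← chain-bounds (f ∘ Fin.suc) c i =
  ≤-trans s≤f₀ f₀≤fᵢ , fᵢ≤t

chain-map : ∀ {n s t s′ t′} {φ : ℚ → ℚ} → φ Preserves _≤_ ⟶ _≤_ →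
            s′ ≤ φ s → φ t ≤ t′ → (f g : Vector ℚ n) → g ≗ φ ∘ f →
            Chain s f t → Chain s′ g t′
chain-map {zero}  φ-mono s′≤φs φt≤t′ f g g≗φf (s≤t ∷ _) =
  ≤-trans s′≤φs (≤-trans (φ-mono s≤t) φt≤t′) ∷ [-]
chain-map {suc n} φ-mono s′≤φs φt≤t′ f g g≗φf (s≤f₀ ∷ c) =
  ≤-trans s′≤φs (≤-trans (φ-mono s≤f₀) (≤-reflexive (sym (g≗φf Fin.zero)))) ∷
  -- In the tail the lower ends are `f Fin.zero` and `g Fin.zero`, matched by `g≗φf`.
  chain-map φ-mono (≤-reflexive (g≗φf Fin.zero)) φt≤t′
    (f ∘ Fin.suc) (g ∘ Fin.suc) (g≗φf ∘ Fin.suc) c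

theorem3p2 : (n : ℕ) → n ≥ 1 →
    (b : Vector ℕ n) (b≢0 : ∀ i → NonZero (b i)) →
    (k : ℕ) (p : Vector ℤ n) → Lattice (Dilated b b≢0 k) p →
    Σ[ ps ∈ Vector (Vector ℤ n) k ]
    (∀ j → Lattice (P b b≢0) (ps j)) × (p ≗ ∑ ps)
theorem3p2 n _ b b≢0 k p p∈kP = ps , ps∈P , p≗∑ps
  where
  ps : Vector (Vector ℤ n) k
  ps j i = slice (+ b i) (toℕ j) (p i)

  ps∈P : ∀ j → Lattice (P b b≢0) (ps j)
  ps∈P j = chain-map (unitSlice-mono-≤ (toℕ j))
    -- Both end conditions hold because the clamp takes values in [0, 1].
    (0≤unitSlice (toℕ j) 0ℚ) (unitSlice≤1 (toℕ j) (+ k / 1))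
    (λ i → quotient (b i) (b≢0 i) (p i)) (λ i → quotient (b i) (b≢0 i) (ps j i))
    (λ i → quotient-slice (b i) (b≢0 i) (toℕ j) (p i)) p∈kP

  p≗∑ps : p ≗ ∑ ps
  p≗∑ps i with (0≤q , q≤k) ← chain-bounds (λ i → quotient (b i) (b≢0 i) (p i)) p∈kP i =
    -- The upper end of the chain bounds `p i` by `k b`, as `sum-slices` requires; the lower end
    -- removes the positive part from its result.
    sym (trans (sum-slices k (+ b i) (p i) (ℤ.+≤+ z≤n) p≤kb) (ℤ.i≤j⇒i⊔j≡j 0≤p))
    where
    0≤p : 0ℤ ℤ.≤ p i
    0≤p = quotient-cancel-≤ (b i) (b≢0 i)
      (≤-trans (≤-reflexive (quotient-0 (b i) (b≢0 i))) 0≤q)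

    p≤kb : p i ℤ.≤ + k ℤ.* + b i
    p≤kb = quotient-cancel-≤ (b i) (b≢0 i)
      (≤-trans q≤k (≤-reflexive (sym (quotient-multiple (b i) (b≢0 i) (+ k)))))
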